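{- For any anti-terms $p,p'\in\mathcal{T}_{\mathcal{E}}(\mathcal{C}\cup\{!\},\mathcal{X})$, if $p\Longrightarrow_{\mathfrak{R}_{!}}p'$ (one rewrite step) then $[\![p]\!]=[\![p']\!]$.
   Context: $\mathcal{C}$ is a set of constructors with arities, $\mathcal{X}$ a countable set of variables, $\mathcal{T}(\mathcal{C})$ the set of ground constructor terms. An anti-term is a linear term built from variables, constructors of $\mathcal{C}$ and the unary complement symbol $!$. More generally, $\mathcal{T}_{\mathcal{E}}(\mathcal{C}\cup\{!\},\mathcal{X})$ is the set of linear extended patterns in which $!$ may occur: $p::=x\in\mathcal{X}\mid c(p_1,\dots,p_n)\mid p_1+p_2\mid p_1\setminus p_2\mid\bot\mid\ !p$, with $c\in\mathcal{C}$ ($+,\setminus,\bot$ formal symbols). Linearity: $p_1+p_2$ is linear if $p_1,p_2$ are; $c(p_1,\dots,p_n)$ is linear if the $p_i$ are linear with disjoint variables; $p_1\setminus p_2$ is linear if $p_1,p_2$ are linear with disjoint variables; $!p$ is linear if $p$ is. Ground semantics: $[\![x]\!]=\mathcal{T}(\mathcal{C})$, $[\![c(p_1,\dots,p_n)]\!]=\{c(t_1,\dots,t_n)\mid t_i\in[\![p_i]\!]\}$ when the $p_i$ contain no $!$ that is reachable from the root through constructors only, $[\![p_1+p_2]\!]=[\![p_1]\!]\cup[\![p_2]\!]$, $[\![p_1\setminus p_2]\!]=[\![p_1]\!]\setminus[\![p_2]\!]$ (set difference), $[\![\bot]\!]=\emptyset$, and $[\![t[!t']_\omega]\!]=[\![t[z]_\omega]\!]\setminus[\![t[t']_\omega]\!]$,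 where $z$ is a fresh variable and all symbols of $t$ at positions strictly above $\omega$ are constructors (in particular different from $!$); here $t[s]_\omega$ denotes $t$ with the subterm at position $\omega$ replaced by $s$. $\mathfrak{R}_{!}$ is the rewriting system with the single rule $!\,t\Rightarrow z\setminus t$, applicable at any position, where $t$ is a rewrite variable ranging over anti-terms (elements of $\mathcal{T}_{\mathcal{E}}(\mathcal{C}\cup\{!\},\mathcal{X})$) and $z$ is a fresh pattern variable. -}

module Defs where

open import Data.Empty using (⊥)
open import Data.Fin using (Fin; zero; suc)
open import Data.Nat using (ℕ)
open import Data.Product using (∃; ∃-syntax; _×_; _,_; proj₁; proj₂)
open import Data.Unit using (⊤; tt)
open import Data.Vec using (Vec; []; _∷_; lookup; _[_]≔_)
open import Level using (0ℓ)
open import Relation.Binary.PropositionalEquality using (_≡_; _≢_; refl)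
open import Relation.Nullary using (¬_)
open import Relation.Unary using (Pred; _∈_; _≐_; _∪_; _∖_; U; ∅)

module Patterns (𝒞 : Set) (arity : 𝒞 → ℕ) (𝒳 : Set) where

  data Ground : Set where
    con : (c : 𝒞) → Vec Ground (arity c) → Ground

  -- Raw extended patterns; the elements of T_E(𝒞 ∪ {!}, 𝒳) are those
  -- satisfying Linear below.
  infixl 6 _⊕_ _⊝_
  infix  8 !_
  data Pattern : Set where
    var     : 𝒳 → Pattern
    con     : (c : 𝒞) → Vec Pattern (arity c) → Pattern
    _⊕_ _⊝_ : Pattern → Pattern → Pattern
    bot     : Pattern
    !_      : Pattern → Pattern

  data Pos : Pattern → Set where
    here : ∀ {p} → Pos p
    con  : ∀ {c ps} (i : Fin (arity c)) → Pos (lookup ps i) → Pos (con c ps)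
    ⊕ˡ   : ∀ {p q} → Pos p → Pos (p ⊕ q)
    ⊕ʳ   : ∀ {p q} → Pos q → Pos (p ⊕ q)
    ⊝ˡ   : ∀ {p q} → Pos p → Pos (p ⊝ q)
    ⊝ʳ   : ∀ {p q} → Pos q → Pos (p ⊝ q)
    !_   : ∀ {p} → Pos p → Pos (! p)

  infix 7 _∣_
  _∣_ : (p : Pattern) → Pos p → Pattern
  p        ∣ here    = p
  con c ps ∣ con i ω = lookup ps i ∣ ω
  (p ⊕ q)  ∣ ⊕ˡ ω    = p ∣ ω
  (p ⊕ q)  ∣ ⊕ʳ ω    = q ∣ ω
  (p ⊝ q)  ∣ ⊝ˡ ω    = p ∣ ω
  (p ⊝ q)  ∣ ⊝ʳ ω    = q ∣ ω
  (! p)    ∣ (! ω)   = p ∣ ω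

  -- p [ s ]at ω replaces the subterm of p at position ω by s.
  infix 7 _[_]at_
  _[_]at_ : (p : Pattern) → Pattern → Pos p → Pattern
  p        [ s ]at here    = s
  con c ps [ s ]at con i ω = con c (ps [ i ]≔ (lookup ps i [ s ]at ω))
  (p ⊕ q)  [ s ]at ⊕ˡ ω    = (p [ s ]at ω) ⊕ q
  (p ⊕ q)  [ s ]at ⊕ʳ ω    = p ⊕ (q [ s ]at ω)
  (p ⊝ q)  [ s ]at ⊝ˡ ω    = (p [ s ]at ω) ⊝ q
  (p ⊝ q)  [ s ]at ⊝ʳ ω    = p ⊝ (q [ s ]at ω)
  (! p)    [ s ]at (! ω)   = ! (p [ s ]at ω)

  -- All symbols strictly above the position are constructors of 𝒞.
  data ConsAbove : ∀ {p} → Pos p → Set where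
    here : ∀ {p} → ConsAbove {p} here
    con  : ∀ {c ps} (i : Fin (arity c)) {ω : Pos (lookup ps i)} →
           ConsAbove ω → ConsAbove {con c ps} (con i ω)

  _occursIn_ : 𝒳 → Pattern → Set
  x occursIn p = ∃[ ω ] p ∣ ω ≡ var x

  FreshFor : 𝒳 → Pattern → Set
  FreshFor z p = ¬ z occursIn p

  DisjointVars : Pattern → Pattern → Set
  DisjointVars p q = ∀ x → x occursIn p → ¬ x occursIn q

  data Linear : Pattern → Set where
    var : ∀ x → Linear (var x)
    con : ∀ {c ps} → (∀ i → Linear (lookup ps i)) →
          (∀ i j → i ≢ j → DisjointVars (lookup ps i) (lookup ps j)) →
          Linear (con c ps)
    _⊕_ : ∀ {p q} → Linear p → Linear q → Linear (p ⊕ q)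
    sub : ∀ {p q} → Linear p → Linear q → DisjointVars p q → Linear (p ⊝ q)
    bot : Linear bot
    !_  : ∀ {p} → Linear p → Linear (! p)

  NoReachable! : Pattern → Set
  NoReachable! p = ∀ (ω : Pos p) → ConsAbove ω → ∀ t → p ∣ ω ≢ ! t

  -- The defining equations of the ground semantics.  The last one holds at
  -- every admissible ω and for every fresh z, so together they are not a
  -- structural recursion; read from left to right they determine ⟦ p ⟧ up to ≐
  -- for every linear p, because replacing !t' by z or by t' removes a
  -- complement.  What ⟦_⟧ does to non-linear raw patterns is left open.
  record IsGroundSemantics (⟦_⟧ : Pattern → Pred Ground 0ℓ) : Set where
    field
      ⟦var⟧ : ∀ x → ⟦ var x ⟧ ≐ U
      ⟦con⟧ : ∀ c ps → Linear (con c ps) → NoReachable! (con c ps) →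
              ⟦ con c ps ⟧ ≐
                λ u → ∃[ ts ] u ≡ con c ts ×
                              (∀ i → lookup ts i ∈ ⟦ lookup ps i ⟧)
      ⟦⊕⟧   : ∀ p q → Linear (p ⊕ q) → ⟦ p ⊕ q ⟧ ≐ ⟦ p ⟧ ∪ ⟦ q ⟧
      ⟦⊝⟧   : ∀ p q → Linear (p ⊝ q) → ⟦ p ⊝ q ⟧ ≐ ⟦ p ⟧ ∖ ⟦ q ⟧
      ⟦bot⟧ : ⟦ bot ⟧ ≐ ∅
      ⟦!⟧   : ∀ t (ω : Pos t) t' z → Linear t → ConsAbove ω →
              t ∣ ω ≡ ! t' → FreshFor z t →
              ⟦ t ⟧ ≐ ⟦ t [ var z ]at ω ⟧ ∖ ⟦ t [ t' ]at ω ⟧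

  -- One step of the system with the single rule  ! t ⇒ z ⊝ t.  The variable z
  -- is fresh for the whole pattern being rewritten, not merely for t: otherwise
  -- the result need not be linear.
  infix 4 _⟹_
  data _⟹_ (p : Pattern) : Pattern → Set where
    step : (ω : Pos p) (t : Pattern) (z : 𝒳) → p ∣ ω ≡ ! t → FreshFor z p →
           p ⟹ p [ var z ⊝ t ]at ω

  -- The defining equations are consistent: a compositional interpretation
  -- satisfies them (even without linearity and freshness).
  mutual
    Sem : Pattern → Pred Ground 0ℓ
    Sem (var x)    u = ⊤
    Sem (con c ps) u = ∃[ ts ] u ≡ con c ts × Sem* ps ts
    Sem (p ⊕ q)      = Sem p ∪ Sem q
    Sem (p ⊝ q)      = Sem p ∖ Sem q
    Sem bot        u = ⊥
    Sem (! p)      u = ¬ Sem p u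

    Sem* : ∀ {n} → Vec Pattern n → Vec Ground n → Set
    Sem* []       []       = ⊤
    Sem* (p ∷ ps) (t ∷ ts) = Sem p t × Sem* ps ts

  Sem*-lookup : ∀ {n} (ps : Vec Pattern n) ts → Sem* ps ts →
                ∀ i → Sem (lookup ps i) (lookup ts i)
  Sem*-lookup (p ∷ ps) (t ∷ ts) (h , hs) zero    = h
  Sem*-lookup (p ∷ ps) (t ∷ ts) (h , hs) (suc i) = Sem*-lookup ps ts hs i

  Sem*-tabulate : ∀ {n} (ps : Vec Pattern n) ts →
                  (∀ i → Sem (lookup ps i) (lookup ts i)) → Sem* ps ts
  Sem*-tabulate []       []       h = tt
  Sem*-tabulate (p ∷ ps) (t ∷ ts) h = h zero , Sem*-tabulate ps ts (λ i → h (suc i))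

  Sem*-update : ∀ {n} (ps : Vec Pattern n) ts i q → Sem* ps ts →
                Sem q (lookup ts i) → Sem* (ps [ i ]≔ q) ts
  Sem*-update (p ∷ ps) (t ∷ ts) zero    q (h , hs) k = k , hs
  Sem*-update (p ∷ ps) (t ∷ ts) (suc i) q (h , hs) k = h , Sem*-update ps ts i q hs k

  Sem*-at : ∀ {n} (ps : Vec Pattern n) ts i q → Sem* (ps [ i ]≔ q) ts →
            Sem q (lookup ts i)
  Sem*-at (p ∷ ps) (t ∷ ts) zero    q (k , hs) = k
  Sem*-at (p ∷ ps) (t ∷ ts) (suc i) q (h , hs) = Sem*-at ps ts i q hs

  Sem*-swap : ∀ {n} (ps : Vec Pattern n) ts i q r → Sem* (ps [ i ]≔ q) ts →
              Sem r (lookup ts i) → Sem* (ps [ i ]≔ r) ts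
  Sem*-swap (p ∷ ps) (t ∷ ts) zero    q r (k , hs) l = l , hs
  Sem*-swap (p ∷ ps) (t ∷ ts) (suc i) q r (h , hs) l = h , Sem*-swap ps ts i q r hs l

  Sem*-restore : ∀ {n} (ps : Vec Pattern n) ts i q → Sem* (ps [ i ]≔ q) ts →
                 Sem (lookup ps i) (lookup ts i) → Sem* ps ts
  Sem*-restore (p ∷ ps) (t ∷ ts) zero    q (k , hs) l = l , hs
  Sem*-restore (p ∷ ps) (t ∷ ts) (suc i) q (h , hs) l = h , Sem*-restore ps ts i q hs l

  Sem-! : ∀ t (ω : Pos t) t' z → ConsAbove ω → t ∣ ω ≡ ! t' →
          Sem t ≐ Sem (t [ var z ]at ω) ∖ Sem (t [ t' ]at ω)
  Sem-! t here t' z here refl = (λ n → tt , n) , proj₂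
  Sem-! (con c ps) (con i ω) t' z (con i a) eq = to , from
    where
    ih : Sem (lookup ps i) ≐
         Sem (lookup ps i [ var z ]at ω) ∖ Sem (lookup ps i [ t' ]at ω)
    ih = Sem-! (lookup ps i) ω t' z a eq
    to : ∀ {u} → u ∈ Sem (con c ps) →
         u ∈ Sem (con c ps [ var z ]at con i ω) ∖ Sem (con c ps [ t' ]at con i ω)
    to (ts , refl , hs) =
      (ts , refl , Sem*-update ps ts i _ hs (proj₁ both)) ,
      λ { (.ts , refl , ks) → proj₂ both (Sem*-at ps ts i _ ks) }
      where both = proj₁ ih (Sem*-lookup ps ts hs i)
    from : ∀ {u} →
           u ∈ Sem (con c ps [ var z ]at con i ω) ∖ Sem (con c ps [ t' ]at con i ω) →
           u ∈ Sem (con c ps)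
    from ((ts , refl , hs) , n) =
      ts , refl , Sem*-restore ps ts i _ hs
        (proj₂ ih (Sem*-at ps ts i _ hs ,
                   λ k → n (ts , refl , Sem*-swap ps ts i _ _ hs k)))

  groundSemantics : ∃ IsGroundSemantics
  groundSemantics = Sem , record
    { ⟦var⟧ = λ _ → (λ _ → tt) , (λ _ → tt)
    ; ⟦con⟧ = λ c ps _ _ →
        (λ { (ts , eq , hs) → ts , eq , Sem*-lookup ps ts hs }) ,
        (λ { (ts , eq , hs) → ts , eq , Sem*-tabulate ps ts hs })
    ; ⟦⊕⟧   = λ _ _ _ → (λ h → h) , (λ h → h)
    ; ⟦⊝⟧   = λ _ _ _ → (λ h → h) , (λ h → h)
    ; ⟦bot⟧ = (λ ()) , (λ ())
    ; ⟦!⟧   = λ t ω t' z _ a eq _ → Sem-! t ω t' z a eq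
    }

{-# OPTIONS --safe #-}

-- The defining equations determine ⟦ p ⟧ up to ≐ on linear patterns: replacing
-- a reachable !t' by a fresh variable or by t' keeps linearity and makes the
-- pattern smaller.  Hence ⟦_⟧ agrees there with the compositional semantics
-- Sem, which is a congruence and sends !t and z ⊝ t to the same set.
module Submission where

open import Defs
open import Data.Fin using (Fin; zero; suc; _≟_)
open import Data.Nat using (ℕ; suc; _+_; _≤_; _<_; z≤n; s≤s)
open import Data.Nat.Induction using (<-wellFounded)
open import Data.Nat.Properties
  using (≤-refl; ≤-trans; n≮n; m≤m+n; m≤n+m; m≤n⇒m≤1+n; +-monoˡ-<; +-monoʳ-<)
open import Data.Product using (∃-syntax; _×_; _,_; proj₁; proj₂)
open import Data.Sum using (_⊎_; inj₁; inj₂; [_,_]′; map₁)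
open import Data.Unit using (tt)
open import Data.Vec using (Vec; []; _∷_; lookup; _[_]≔_)
open import Data.Vec.Properties using (lookup∘update; lookup∘update′)
open import Function.Base using (_∘_; const)
open import Function.Bundles using (_↔_; Inverse)
open import Induction.WellFounded using (Acc; acc)
open import Level using (0ℓ)
open import Relation.Binary.PropositionalEquality
  using (_≡_; _≢_; refl; sym; subst)
open import Relation.Nullary using (yes; no; contradiction)
open import Relation.Unary using (Pred; _≐_; _∪_; _∖_)
open import Relation.Unary.Properties using (≐-refl; ≐-sym; ≐-trans)

-- Congruence of the set operations and of the compositional semantics.

∪-cong : ∀ {A : Set} {P P′ Q Q′ : Pred A 0ℓ} →
         P ≐ P′ → Q ≐ Q′ → P ∪ Q ≐ P′ ∪ Q′
∪-cong (f , f⁻) (g , g⁻) =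
  [ inj₁ ∘ f , inj₂ ∘ g ]′ , [ inj₁ ∘ f⁻ , inj₂ ∘ g⁻ ]′

∖-cong : ∀ {A : Set} {P P′ Q Q′ : Pred A 0ℓ} →
         P ≐ P′ → Q ≐ Q′ → P ∖ Q ≐ P′ ∖ Q′
∖-cong (f , f⁻) (g , g⁻) =
  (λ (h , n) → f h , n ∘ g⁻) , (λ (h , n) → f⁻ h , n ∘ g)

module _ {𝒞 : Set} {arity : 𝒞 → ℕ} {𝒳 : Set} where
  open Patterns 𝒞 arity 𝒳

  -- `Sem` interprets every symbol, `!` included, through the sets denoted by its arguments, so an
  -- equality at `ω` propagates to the root, whatever symbols lie above.
  Sem-replace : ∀ p (ω : Pos p) {s} → Sem (p ∣ ω) ≐ Sem s →
                Sem p ≐ Sem (p [ s ]at ω)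
  Sem-replace p          here      e = e
  Sem-replace (con c ps) (con i ω) e =
    (λ (ts , eq , hs) →
       ts , eq , Sem*-update ps ts i _ hs (proj₁ ih (Sem*-lookup ps ts hs i))) ,
    (λ (ts , eq , hs) →
       ts , eq , Sem*-restore ps ts i _ hs (proj₂ ih (Sem*-at ps ts i _ hs)))
    where ih = Sem-replace (lookup ps i) ω e
  Sem-replace (p ⊕ q) (⊕ˡ ω) e =
    ∪-cong {Q = Sem q} (Sem-replace p ω e) ≐-refl
  Sem-replace (p ⊕ q) (⊕ʳ ω) e =
    ∪-cong {P = Sem p} ≐-refl (Sem-replace q ω e)
  Sem-replace (p ⊝ q) (⊝ˡ ω) e =
    ∖-cong {Q = Sem q} (Sem-replace p ω e) ≐-refl
  Sem-replace (p ⊝ q) (⊝ʳ ω) e =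
    ∖-cong {P = Sem p} ≐-refl (Sem-replace q ω e)
  Sem-replace (! p) (! ω) e = (_∘ proj₂ ih) , (_∘ proj₁ ih)
    where ih = Sem-replace p ω e

  Sem-step : ∀ {p p′} → p ⟹ p′ → Sem p ≐ Sem p′
  Sem-step {p} (step ω t z eq _) = Sem-replace p ω
    -- `Sem (var z)` is the full set, so `! t` and `var z ⊝ t` both denote the complement of
    -- `Sem t`.
    (subst (λ q → Sem q ≐ Sem (var z ⊝ t)) (sym eq) ((λ n → tt , n) , proj₂))

  -- Weights of patterns and fresh variables.

  -- One fold serves twice: with w = const 0 it is the termination measure, with
  -- w an injective numbering it bounds the variables that occur.
  mutual
    weight : (𝒳 → ℕ) → Pattern → ℕ
    weight w (var x)    = w x
    weight w (con c ps) = suc (weight* w ps)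
    weight w (p ⊕ q)    = suc (weight w p + weight w q)
    weight w (p ⊝ q)    = suc (weight w p + weight w q)
    weight w bot        = 0
    weight w (! p)      = suc (weight w p)

    weight* : ∀ {n} → (𝒳 → ℕ) → Vec Pattern n → ℕ
    weight* w []       = 0
    weight* w (p ∷ ps) = weight w p + weight* w ps

  weight-lookup : ∀ w {n} (ps : Vec Pattern n) i →
                  weight w (lookup ps i) ≤ weight* w ps
  weight-lookup w (p ∷ ps) zero    = m≤m+n _ _
  weight-lookup w (p ∷ ps) (suc i) = ≤-trans (weight-lookup w ps i) (m≤n+m _ _)

  weight-∣ : ∀ w p (ω : Pos p) → weight w (p ∣ ω) ≤ weight w p
  weight-∣ w p          here      = ≤-refl
  weight-∣ w (con c ps) (con i ω) = m≤n⇒m≤1+n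
    (≤-trans (weight-∣ w (lookup ps i) ω) (weight-lookup w ps i))
  weight-∣ w (p ⊕ q) (⊕ˡ ω) = m≤n⇒m≤1+n (≤-trans (weight-∣ w p ω) (m≤m+n _ _))
  weight-∣ w (p ⊕ q) (⊕ʳ ω) = m≤n⇒m≤1+n (≤-trans (weight-∣ w q ω) (m≤n+m _ _))
  weight-∣ w (p ⊝ q) (⊝ˡ ω) = m≤n⇒m≤1+n (≤-trans (weight-∣ w p ω) (m≤m+n _ _))
  weight-∣ w (p ⊝ q) (⊝ʳ ω) = m≤n⇒m≤1+n (≤-trans (weight-∣ w q ω) (m≤n+m _ _))
  weight-∣ w (! p)   (! ω)  = m≤n⇒m≤1+n (weight-∣ w p ω)

  weight*-update-< : ∀ w {n} (ps : Vec Pattern n) i {q} →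
                     weight w q < weight w (lookup ps i) →
                     weight* w (ps [ i ]≔ q) < weight* w ps
  weight*-update-< w (p ∷ ps) zero    lt = +-monoˡ-< _ lt
  weight*-update-< w (p ∷ ps) (suc i) lt =
    +-monoʳ-< (weight w p) (weight*-update-< w ps i lt)

  weight-replace-< : ∀ w p (ω : Pos p) {s} → weight w s < weight w (p ∣ ω) →
                     weight w (p [ s ]at ω) < weight w p
  weight-replace-< w p          here      lt = lt
  weight-replace-< w (con c ps) (con i ω) lt =
    s≤s (weight*-update-< w ps i (weight-replace-< w (lookup ps i) ω lt))
  weight-replace-< w (p ⊕ q) (⊕ˡ ω) lt = s≤s (+-monoˡ-< _ (weight-replace-< w p ω lt))
  weight-replace-< w (p ⊕ q) (⊕ʳ ω) lt =
    s≤s (+-monoʳ-< (weight w p) (weight-replace-< w q ω lt))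
  weight-replace-< w (p ⊝ q) (⊝ˡ ω) lt = s≤s (+-monoˡ-< _ (weight-replace-< w p ω lt))
  weight-replace-< w (p ⊝ q) (⊝ʳ ω) lt =
    s≤s (+-monoʳ-< (weight w p) (weight-replace-< w q ω lt))
  weight-replace-< w (! p)   (! ω)  lt = s≤s (weight-replace-< w p ω lt)

  fresh : 𝒳 ↔ ℕ → ∀ p → ∃[ z ] FreshFor z p
  -- With variables weighted by `suc ∘ to`, each variable of `p` has its number strictly below the
  -- weight of `p`, so the variable numbered by that weight cannot occur.
  fresh 𝒳↔ℕ p = from (weight (suc ∘ to) p) , λ (ω , eq) → n≮n _
    (subst (λ n → suc n ≤ weight (suc ∘ to) p) (strictlyInverseˡ _)
      (subst (λ q → weight (suc ∘ to) q ≤ weight (suc ∘ to) p) eq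
        (weight-∣ (suc ∘ to) p ω)))
    where open Inverse 𝒳↔ℕ

  -- Occurrences and linearity under replacement.

  occursIn-∣ : ∀ {x} p (ω : Pos p) → x occursIn (p ∣ ω) → x occursIn p
  occursIn-∣ p          here      o = o
  occursIn-∣ (con c ps) (con i ω) o with occursIn-∣ (lookup ps i) ω o
  ... | ω′ , eq = con i ω′ , eq
  occursIn-∣ (p ⊕ q) (⊕ˡ ω) o with occursIn-∣ p ω o
  ... | ω′ , eq = ⊕ˡ ω′ , eq
  occursIn-∣ (p ⊕ q) (⊕ʳ ω) o with occursIn-∣ q ω o
  ... | ω′ , eq = ⊕ʳ ω′ , eq
  occursIn-∣ (p ⊝ q) (⊝ˡ ω) o with occursIn-∣ p ω o
  ... | ω′ , eq = ⊝ˡ ω′ , eq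
  occursIn-∣ (p ⊝ q) (⊝ʳ ω) o with occursIn-∣ q ω o
  ... | ω′ , eq = ⊝ʳ ω′ , eq
  occursIn-∣ (! p) (! ω) o with occursIn-∣ p ω o
  ... | ω′ , eq = (! ω′) , eq

  occursIn-con : ∀ {x c ps} i → x occursIn lookup ps i → x occursIn con c ps
  occursIn-con i (ω , eq) = con i ω , eq

  -- The position of the occurrence either leaves the path to `ω` and ends in an untouched argument,
  -- or follows it to the end and lies in `s`.
  occursIn-replace : ∀ {x s p} {ω : Pos p} → ConsAbove ω →
                     x occursIn (p [ s ]at ω) → x occursIn p ⊎ x occursIn s
  occursIn-replace here o = inj₂ o
  occursIn-replace (con i a) (here , ())
  occursIn-replace {x} (con {ps = ps} i a) (con j ω′ , eq) with j ≟ i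
  ... | yes refl = map₁ (occursIn-con i)
        (occursIn-replace a (subst (x occursIn_) (lookup∘update i ps _) (ω′ , eq)))
  ... | no j≢i = inj₁ (occursIn-con j
        (subst (x occursIn_) (lookup∘update′ j≢i ps _) (ω′ , eq)))

  Linear-∣ : ∀ {p} {ω : Pos p} → ConsAbove ω → Linear p → Linear (p ∣ ω)
  Linear-∣ here      l         = l
  Linear-∣ (con i a) (con l _) = Linear-∣ a (l i)

  Linear-update : ∀ {c} {ps : Vec Pattern (arity c)} {i q} → Linear (con c ps) →
                  Linear q →
                  (∀ j → i ≢ j → DisjointVars q (lookup ps j)) →
                  Linear (con c (ps [ i ]≔ q))
  Linear-update {c} {ps} {i} {q} (con l d) lq dq = con lin disj
    where
    qs = ps [ i ]≔ q

    lin : ∀ j → Linear (lookup qs j)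
    lin j with j ≟ i
    ... | yes refl rewrite lookup∘update i ps q = lq
    ... | no j≢i   rewrite lookup∘update′ j≢i ps q = l j

    disj : ∀ j k → j ≢ k → DisjointVars (lookup qs j) (lookup qs k)
    disj j k j≢k with j ≟ i | k ≟ i
    ... | yes refl | yes refl = contradiction refl j≢k
    ... | yes refl | no k≢i
      rewrite lookup∘update i ps q | lookup∘update′ k≢i ps q = dq k j≢k
    ... | no j≢i | yes refl
      rewrite lookup∘update i ps q | lookup∘update′ j≢i ps q =
        -- `dq` covers one order of the two arguments; disjointness is symmetric.
        λ x o o′ → dq j (j≢i ∘ sym) x o′ o
    ... | no j≢i | no k≢i
      rewrite lookup∘update′ j≢i ps q | lookup∘update′ k≢i ps q = d j k j≢k

  -- A variable of `s` taken from the replaced subterm cannot occur in a sibling argument, by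
  -- linearity of `p`; one fresh for `p` occurs in none. The two alternatives serve the replacements
  -- of `! t` by `t` and by `var z`.
  Linear-replace : ∀ {p s} {ω : Pos p} → ConsAbove ω → Linear p → Linear s →
                   (∀ x → x occursIn s → x occursIn (p ∣ ω) ⊎ FreshFor x p) →
                   Linear (p [ s ]at ω)
  Linear-replace here lp ls _ = ls
  Linear-replace {s = s} (con {ps = ps} i {ω} a) lp@(con l d) ls v =
    Linear-update lp
      (Linear-replace a (l i) ls
        (λ x o → [ inj₁ , (λ f → inj₂ (f ∘ occursIn-con i)) ]′ (v x o)))
      disj
    where
    disj : ∀ j → i ≢ j → DisjointVars (lookup ps i [ s ]at ω) (lookup ps j)
    disj j i≢j x o o′ with occursIn-replace a o
    ... | inj₁ o₁ = d i j i≢j x o₁ o′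
    ... | inj₂ o₂ with v x o₂
    ...   | inj₁ o₃ = d i j i≢j x (occursIn-∣ (lookup ps i) ω o₃) o′
    ...   | inj₂ f  = f (occursIn-con j o′)

  -- Search for a reachable complement.

  Reachable! : Pattern → Set
  Reachable! p = ∃[ ω ] ConsAbove {p} ω × ∃[ t ] p ∣ ω ≡ ! t

  mutual
    -- Below a root other than a constructor no position satisfies `ConsAbove`, so the search
    -- descends through constructors alone and otherwise inspects just the root.
    reachable!? : ∀ p → Reachable! p ⊎ NoReachable! p
    reachable!? (var x)    = inj₂ λ { .here here _ () }
    reachable!? (con c ps) with reachable!?* ps
    ... | inj₁ (i , ω , a , t , eq) = inj₁ (con i ω , con i a , t , eq)
    ... | inj₂ n = inj₂ λ { .here here _ () ; (con i ω) (con .i a) → n i ω a }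
    reachable!? (p ⊕ q)    = inj₂ λ { .here here _ () }
    reachable!? (p ⊝ q)    = inj₂ λ { .here here _ () }
    reachable!? bot        = inj₂ λ { .here here _ () }
    reachable!? (! p)      = inj₁ (here , here , p , refl)

    reachable!?* : ∀ {n} (ps : Vec Pattern n) →
                   (∃[ i ] Reachable! (lookup ps i)) ⊎
                   (∀ i → NoReachable! (lookup ps i))
    reachable!?* []       = inj₂ λ ()
    reachable!?* (p ∷ ps) with reachable!? p | reachable!?* ps
    ... | inj₁ r | _            = inj₁ (zero , r)
    ... | inj₂ _ | inj₁ (i , r) = inj₁ (suc i , r)
    ... | inj₂ m | inj₂ n       = inj₂ λ { zero → m ; (suc i) → n i }

  -- Agreement with the compositional semantics on linear patterns.

  module Uniqueness (𝒳↔ℕ : 𝒳 ↔ ℕ) {⟦_⟧ : Pattern → Pred Ground 0ℓ}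
                    (S : IsGroundSemantics ⟦_⟧) where
    open IsGroundSemantics S

    size : Pattern → ℕ
    size = weight (const 0)

    -- The equation `⟦!⟧` leads to patterns that are not subterms of `p`, hence the induction on
    -- `size`. Reachable complements are treated first because `⟦con⟧` applies only in their
    -- absence.
    Linear⇒⟦⟧≐Sem-acc : ∀ p → Acc _<_ (size p) → Linear p → ⟦ p ⟧ ≐ Sem p
    Linear⇒⟦⟧≐Sem-acc p (acc rs) lp with reachable!? p
    ... | inj₁ (ω , a , t , eq) =
      -- Both semantics split at `ω` into the same difference, so it is enough to compare them on
      -- its two smaller patterns.
      ≐-trans (⟦!⟧ p ω t z lp a eq z∉p)
        (≐-trans (∖-cong ⟦z⟧≐ ⟦t⟧≐) (≐-sym (Sem-! p ω t z a eq)))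
      where
      z   = proj₁ (fresh 𝒳↔ℕ p)
      z∉p = proj₂ (fresh 𝒳↔ℕ p)

      smaller : ∀ {s} → size s < suc (size t) → size (p [ s ]at ω) < size p
      smaller {s} lt = weight-replace-< (const 0) p ω
        (subst (λ q → size s < size q) (sym eq) lt)

      Linear-body : ∀ {q} → q ≡ ! t → Linear q → Linear t
      Linear-body refl (! l) = l

      ⟦z⟧≐ : ⟦ p [ var z ]at ω ⟧ ≐ Sem (p [ var z ]at ω)
      -- A variable has size 0, which is below the size of any complement, even that of `! bot`.
      ⟦z⟧≐ = Linear⇒⟦⟧≐Sem-acc _ (rs (smaller (s≤s z≤n)))
        (Linear-replace a lp (var z) λ { .z (here , refl) → inj₂ z∉p })

      ⟦t⟧≐ : ⟦ p [ t ]at ω ⟧ ≐ Sem (p [ t ]at ω)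
      ⟦t⟧≐ = Linear⇒⟦⟧≐Sem-acc _ (rs (smaller ≤-refl))
        (Linear-replace a lp (Linear-body eq (Linear-∣ a lp))
          λ x o → inj₁ (subst (x occursIn_) (sym eq) (occursIn-∣ (! t) (! here) o)))
    Linear⇒⟦⟧≐Sem-acc (var x) _ _ | inj₂ _ = ⟦var⟧ x
    Linear⇒⟦⟧≐Sem-acc (con c ps) (acc rs) lp@(con l _) | inj₂ n =
      ≐-trans (⟦con⟧ c ps lp n)
        ( (λ (ts , eq , h) → ts , eq , Sem*-tabulate ps ts (λ i → proj₁ (ih i) (h i)))
        , (λ (ts , eq , h) → ts , eq , λ i → proj₂ (ih i) (Sem*-lookup ps ts h i)) )
      where
      ih : ∀ i → ⟦ lookup ps i ⟧ ≐ Sem (lookup ps i)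
      ih i = Linear⇒⟦⟧≐Sem-acc _ (rs (s≤s (weight-lookup (const 0) ps i))) (l i)
    Linear⇒⟦⟧≐Sem-acc (p ⊕ q) (acc rs) l@(lp ⊕ lq) | inj₂ _ =
      ≐-trans (⟦⊕⟧ p q l)
        (∪-cong (Linear⇒⟦⟧≐Sem-acc p (rs (s≤s (m≤m+n _ _))) lp)
                (Linear⇒⟦⟧≐Sem-acc q (rs (s≤s (m≤n+m _ _))) lq))
    Linear⇒⟦⟧≐Sem-acc (p ⊝ q) (acc rs) l@(sub lp lq _) | inj₂ _ =
      ≐-trans (⟦⊝⟧ p q l)
        (∖-cong (Linear⇒⟦⟧≐Sem-acc p (rs (s≤s (m≤m+n _ _))) lp)
                (Linear⇒⟦⟧≐Sem-acc q (rs (s≤s (m≤n+m _ _))) lq))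
    Linear⇒⟦⟧≐Sem-acc bot _ _ | inj₂ _ = ⟦bot⟧
    -- Vacuous: the root is itself a reachable complement.
    Linear⇒⟦⟧≐Sem-acc (! p) _ _ | inj₂ n = contradiction refl (n here here p)

    Linear⇒⟦⟧≐Sem : ∀ {p} → Linear p → ⟦ p ⟧ ≐ Sem p
    Linear⇒⟦⟧≐Sem {p} = Linear⇒⟦⟧≐Sem-acc p (<-wellFounded _)

proposition3p4 : (𝒞 : Set) (arity : 𝒞 → ℕ) (𝒳 : Set) → 𝒳 ↔ ℕ →
    let open Patterns 𝒞 arity 𝒳 in
    (⟦_⟧ : Pattern → Pred Ground 0ℓ) → IsGroundSemantics ⟦_⟧ →
    (p p' : Pattern) → Linear p → Linear p' →
    p ⟹ p' → ⟦ p ⟧ ≐ ⟦ p' ⟧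
proposition3p4 𝒞 arity 𝒳 𝒳↔ℕ ⟦_⟧ S p p' lp lp' p⟹p' =
  ≐-trans (Linear⇒⟦⟧≐Sem lp) (≐-trans (Sem-step p⟹p') (≐-sym (Linear⇒⟦⟧≐Sem lp')))
  where open Uniqueness 𝒳↔ℕ S
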